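{- The HDA $\mathcal{A} \otimes \mathcal{B}$ satisfies conditions HM1-HM3 for the $\ltimes$-transition system $\mathcal{S} \mathbin{|||} \mathcal{T}$.
   Context: $\mathcal{S}$ and $\mathcal{T}$ are $\ltimes$-transition systems (transition systems, i.e. 1-truncated HDAs in which two edges with the same label and endpoints are equal, together with a relation $\ltimes$ on labels), and $\mathcal{A}$, $\mathcal{B}$ are HDA models of $\mathcal{S}$, $\mathcal{T}$. An HDA $\mathcal{A}$ is an HDA model of a $\ltimes$-transition system $\mathcal{T}$ if: (HM1) $\mathcal{A}_{\le1}=U(\mathcal{T})$; (HM2) for all 2-cubes $x$, $\lambda_\mathcal{A}(d^0_2x)\ltimes_\mathcal{T}\lambda_\mathcal{A}(d^0_1x)$; (HM3) for $m\ge2$, two $m$-cubes with all the same faces $d^k_r$ are equal; (HM4) $\mathcal{A}$ is maximal, i.e. not a proper subautomaton of any HDA satisfying HM1–HM3. $\mathcal{A}\otimes\mathcal{B}$ is the tensor product of HDAs (tensor product of precubical sets, initial state $(I_\mathcal{A},I_\mathcal{B})$, final states $F_\mathcal{A}\times F_\mathcal{B}$, labels $\Sigma_\mathcal{A}\amalg\Sigma_\mathcal{B}$, edge $(x,y)$ labeled by the label of its 1-dimensional component). $\mathcal{S}\mathbin{|||}\mathcal{T}$ is the interleaving: underlying transition system $(U(\mathcal{S})\otimes U(\mathcal{T}))_{\le1}$, with $\alpha\ltimes\beta$ iff either $\alpha,\beta\in\Sigma_\mathcal{S}$ and $\alpha\ltimes_\mathcal{S}\beta$, or $\alpha,\beta\in\Sigma_\mathcal{T}$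 and $\alpha\ltimes_\mathcal{T}\beta$, or $\alpha\in\Sigma_\mathcal{S}$ and $\beta\in\Sigma_\mathcal{T}$. -}

module Defs where

open import Data.Nat using (ℕ; zero; suc; _+_; _≤_)
open import Data.Nat.Properties using (suc-injective; +-suc)
open import Data.Fin using (Fin; zero; suc; toℕ; inject₁; splitAt; cast)
open import Data.Bool using (Bool; true; false)
open import Data.Sum using (_⊎_; inj₁; inj₂)
open import Data.Product using (Σ; Σ-syntax; _×_; _,_)
open import Data.Empty using (⊥)
open import Data.Unit using (⊤)
open import Relation.Nullary using (¬_)
open import Relation.Binary.PropositionalEquality using (_≡_; refl; sym; trans)
open import Function.Bundles using (_↔_; _⇔_; Inverse)

-- Conventions
--  * face index k ∈ {0,1} is a Bool (false = 0, true = 1);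
--  * the face position r ∈ {1,…,n} of the paper is a Fin n, 0-based,
--    so the paper's d^k_r is  face k (r - 1).
--  * the alphabet L of an HDA is a parameter of the record.

record PreHDA (L : Set) : Set₁ where
  field
    Cell  : ℕ → Set
    face  : ∀ {n} → Bool → Fin (suc n) → Cell (suc n) → Cell n
    init  : Cell 0
    Final : Cell 0 → Set
    lab   : Cell 1 → L

-- A higher-dimensional automaton over L: a precubical set
-- (precubical identities d^k_i d^l_j = d^l_{j-1} d^k_i for i < j),
-- an initial state, a set of final states, and a labelling
-- λ : P₁ → L with λ(d^0_i x) = λ(d^1_i x) for x ∈ P₂, i ∈ {1,2}.
record HDA (L : Set) : Set₁ where
  field
    pre : PreHDA L
  open PreHDA pre public
  field
    cubical  : ∀ {n} (k l : Bool) (i j : Fin (suc n)) → toℕ i ≤ toℕ j →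
               (x : Cell (suc (suc n))) →
               face k i (face l (suc j) x) ≡ face l j (face k (inject₁ i) x)
    lab-face : (i : Fin 2) (x : Cell 2) → lab (face false i x) ≡ lab (face true i x)

record ⋉TS (L : Set) : Set₁ where
  field
    hda : HDA L
  open HDA hda
  field
    truncated   : ∀ n → ¬ Cell (suc (suc n))
    edge-unique : (e e′ : Cell 1) → lab e ≡ lab e′ →
                  face false zero e ≡ face false zero e′ →
                  face true zero e ≡ face true zero e′ → e ≡ e′
    _⋉_ : L → L → Set

U : ∀ {L} → ⋉TS L → PreHDA L
U T = HDA.pre (⋉TS.hda T)

module _ {L : Set} (A : PreHDA L) where
  open PreHDA A

  private
    TrCell : ℕ → Set
    TrCell zero = Cell 0
    TrCell (suc zero) = Cell 1
    TrCell (suc (suc n)) = ⊥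

    trface : ∀ {n} → Bool → Fin (suc n) → TrCell (suc n) → TrCell n
    trface {zero} k i x = face k i x
    trface {suc n} k i ()

  truncate≤1 : PreHDA L
  truncate≤1 = record
    { Cell = TrCell ; face = trface ; init = init ; Final = Final ; lab = lab }

-- Tensor product  A ⊗ B :  (A ⊗ B)_n = ∐_{p+q=n} A_p × B_q,
-- d^k_i (x , y) = (d^k_i x , y)       if 1 ≤ i ≤ p,
--               = (x , d^k_{i-p} y)   if p+1 ≤ i ≤ p+q;
-- initial state (I_A , I_B), final states F_A × F_B,
-- labels L₁ ⊎ L₂, an edge labelled by its 1-dimensional component.

module _ {L₁ L₂ : Set} (A : PreHDA L₁) (B : PreHDA L₂) where
  private
    module A = PreHDA A
    module B = PreHDA B

    TCell : ℕ → Set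
    TCell n = Σ[ p ∈ ℕ ] Σ[ q ∈ ℕ ] (p + q ≡ n) × A.Cell p × B.Cell q

    go : ∀ {n} → Bool → (p q : ℕ) → p + q ≡ suc n → A.Cell p → B.Cell q →
         Fin p ⊎ Fin q → TCell n
    go k (suc p) q eq x y (inj₁ j) = p , q , suc-injective eq , A.face k j x , y
    go k zero q eq x y (inj₁ ())
    go k p (suc q) eq x y (inj₂ j) =
      p , q , suc-injective (trans (sym (+-suc p q)) eq) , x , B.face k j y
    go k p zero eq x y (inj₂ ())

    tface : ∀ {n} → Bool → Fin (suc n) → TCell (suc n) → TCell n
    tface k i (p , q , eq , x , y) = go k p q eq x y (splitAt p (cast (sym eq) i))

    tFinal : TCell 0 → Set
    tFinal (zero , zero , refl , x , y) = A.Final x × B.Final y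
    tFinal (zero , suc q , () , x , y)
    tFinal (suc p , q , () , x , y)

    tlab : TCell 1 → L₁ ⊎ L₂
    tlab (suc zero , zero , refl , x , y) = inj₁ (A.lab x)
    tlab (zero , suc zero , refl , x , y) = inj₂ (B.lab y)
    tlab (zero , zero , () , x , y)
    tlab (zero , suc (suc q) , () , x , y)
    tlab (suc zero , suc q , () , x , y)
    tlab (suc (suc p) , q , () , x , y)

  _⊗_ : PreHDA (L₁ ⊎ L₂)
  _⊗_ = record
    { Cell  = TCell
    ; face  = tface
    ; init  = 0 , 0 , refl , A.init , B.init
    ; Final = tFinal
    ; lab   = tlab
    }

-- Interleaving  S ||| T  (given by its underlying transition system
-- (U(S) ⊗ U(T))_{≤1} and its relation ⋉ on L₁ ⊎ L₂)

interleave-U : ∀ {L₁ L₂} → ⋉TS L₁ → ⋉TS L₂ → PreHDA (L₁ ⊎ L₂)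
interleave-U S T = truncate≤1 (U S ⊗ U T)

interleave-⋉ : ∀ {L₁ L₂} → ⋉TS L₁ → ⋉TS L₂ → L₁ ⊎ L₂ → L₁ ⊎ L₂ → Set
interleave-⋉ S T (inj₁ a) (inj₁ b) = ⋉TS._⋉_ S a b
interleave-⋉ S T (inj₂ a) (inj₂ b) = ⋉TS._⋉_ T a b
interleave-⋉ S T (inj₁ a) (inj₂ b) = ⊤
interleave-⋉ S T (inj₂ a) (inj₁ b) = ⊥

-- Isomorphism of (pre-)HDAs over the same alphabet (used to render
-- the equality A_{≤1} = U(T) of HM1).

record _≅_ {L : Set} (A B : PreHDA L) : Set where
  private
    module A = PreHDA A
    module B = PreHDA B
  field
    iso        : ∀ n → A.Cell n ↔ B.Cell n
  map : ∀ {n} → A.Cell n → B.Cell n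
  map {n} = Inverse.to (iso n)
  field
    face-pres  : ∀ {n} (k : Bool) (i : Fin (suc n)) (x : A.Cell (suc n)) →
                 map (A.face k i x) ≡ B.face k i (map x)
    init-pres  : map A.init ≡ B.init
    final-pres : (x : A.Cell 0) → A.Final x ⇔ B.Final (map x)
    lab-pres   : (e : A.Cell 1) → B.lab (map e) ≡ A.lab e

record _↪_ {L : Set} (A B : PreHDA L) : Set where
  private
    module A = PreHDA A
    module B = PreHDA B
  field
    map        : ∀ {n} → A.Cell n → B.Cell n
    injective  : ∀ {n} {x y : A.Cell n} → map x ≡ map y → x ≡ y
    face-pres  : ∀ {n} (k : Bool) (i : Fin (suc n)) (x : A.Cell (suc n)) →
                 map (A.face k i x) ≡ B.face k i (map x)
    init-pres  : map A.init ≡ B.init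
    final-pres : (x : A.Cell 0) → A.Final x ⇔ B.Final (map x)
    lab-pres   : (e : A.Cell 1) → B.lab (map e) ≡ A.lab e

Proper : ∀ {L} {A B : PreHDA L} → A ↪ B → Set
Proper {A = A} {B} ι =
  Σ[ n ∈ ℕ ] Σ[ y ∈ PreHDA.Cell B n ] ¬ (Σ[ x ∈ PreHDA.Cell A n ] _↪_.map ι x ≡ y)

HM1 : ∀ {L} → PreHDA L → (Uₜ : PreHDA L) → Set
HM1 A Uₜ = truncate≤1 A ≅ Uₜ

HM2 : ∀ {L} → PreHDA L → (L → L → Set) → Set
HM2 A R = (x : PreHDA.Cell A 2) →
  R (PreHDA.lab A (PreHDA.face A false (suc zero) x))
    (PreHDA.lab A (PreHDA.face A false zero x))

HM3 : ∀ {L} → PreHDA L → Set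
HM3 A = ∀ n (x y : PreHDA.Cell A (suc (suc n))) →
  (∀ (k : Bool) (r : Fin (suc (suc n))) → PreHDA.face A k r x ≡ PreHDA.face A k r y) →
  x ≡ y

HM4 : ∀ {L} → HDA L → ⋉TS L → Set₁
HM4 {L} A T = (B : HDA L) →
  HM1 (HDA.pre B) (U T) → HM2 (HDA.pre B) (⋉TS._⋉_ T) → HM3 (HDA.pre B) →
  (ι : HDA.pre A ↪ HDA.pre B) → ¬ Proper ι

record IsHDAModel {L : Set} (A : HDA L) (T : ⋉TS L) : Set₁ where
  field
    hm1 : HM1 (HDA.pre A) (U T)
    hm2 : HM2 (HDA.pre A) (⋉TS._⋉_ T)
    hm3 : HM3 (HDA.pre A)
    hm4 : HM4 A T

-- A cell of A ⊗ B of dimension at most 1 has at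
-- most one component of positive dimension, so the 1-truncation of A ⊗ B only depends on
-- the 1-truncations of A and B (HM1); a square of A ⊗ B is a square of A, a square of B,
-- or an edge of A times an edge of B, whose faces d⁰₂ and d⁰₁ carry a label of A and a
-- label of B respectively, a pair related by the interleaving (HM2).  For HM3, the face
-- dᵏᵢ of x ∈ A_p × B_q lies in A_{p-1} × B_q for i ≤ p and in A_p × B_{q-1} for i > p.
-- Since x has at least two face positions, p is read off from the left dimensions of its
-- faces.  A face of the second kind leaves the A-component unchanged, and if there is
-- none (q = 0) the faces of x are those of its A-component, where HM3 for A applies;
-- symmetrically for the B-component.
module Submission where

open import Defs
open import Data.Nat using (ℕ; zero; suc; _+_; _≤_; _<_; z≤n; s≤s)
open import Data.Nat.Properties
  using (suc-injective; +-suc; +-identityʳ; +-cancelˡ-≡; ≡-irrelevant; <-cmp; <⇒≱; ≤-reflexive; <-≤-trans; m≤m+n; 0≢1+n; 1+n≢n; module ≤-Reasoning)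
open import Data.Fin using (Fin; zero; suc; toℕ; splitAt; cast; _↑ˡ_; _↑ʳ_; fromℕ<)
open import Data.Fin.Properties
  using (toℕ<n; toℕ-cast; toℕ-↑ˡ; toℕ-↑ʳ; toℕ-fromℕ<; cast-involutive; splitAt-↑ˡ; splitAt-↑ʳ; splitAt⁻¹-↑ˡ; splitAt⁻¹-↑ʳ)
open import Data.Bool using (Bool; false)
open import Data.Sum using (inj₁; inj₂)
open import Data.Product using (_×_; _,_; proj₁; proj₂)
open import Data.Empty using (⊥-elim)
open import Relation.Nullary using (¬_)
open import Relation.Binary.Definitions using (tri<; tri≈; tri>)
open import Relation.Binary.PropositionalEquality
  using (_≡_; _≢_; refl; sym; trans; cong; cong₂; subst; module ≡-Reasoning)
open import Function.Bundles using (Inverse; _⇔_; mk↔ₛ′)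
open import Data.Product.Function.NonDependent.Propositional using (_×-⇔_)

toℕ-splitAt-inj₁ : ∀ {m n} {i : Fin (m + n)} {j : Fin m} → splitAt m i ≡ inj₁ j → toℕ j ≡ toℕ i
toℕ-splitAt-inj₁ {n = n} {j = j} s = trans (sym (toℕ-↑ˡ j n)) (cong toℕ (splitAt⁻¹-↑ˡ s))

toℕ-splitAt-inj₂ : ∀ {m n} {i : Fin (m + n)} {j : Fin n} → splitAt m i ≡ inj₂ j → m + toℕ j ≡ toℕ i
toℕ-splitAt-inj₂ {m} {j = j} s = trans (sym (toℕ-↑ʳ m j)) (cong toℕ (splitAt⁻¹-↑ʳ s))

module ⊗-Cubes {L₁ L₂ : Set} (A : PreHDA L₁) (B : PreHDA L₂) where
  private
    module A = PreHDA A
    module B = PreHDA B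
    module A⊗B = PreHDA (A ⊗ B)

  leftDim : ∀ {n} → A⊗B.Cell n → ℕ
  leftDim = proj₁

  leftDim≤ : ∀ {n} (c : A⊗B.Cell n) → leftDim c ≤ n
  leftDim≤ (p , q , eq , _ , _) = subst (p ≤_) eq (m≤m+n p q)

  ⊗-cell-injective : ∀ {n p q} {eq : p + q ≡ n} {a a′ : A.Cell p} {b b′ : B.Cell q} →
    _≡_ {A = A⊗B.Cell n} (p , q , eq , a , b) (p , q , eq , a′ , b′) → a ≡ a′ × b ≡ b′
  ⊗-cell-injective refl = refl , refl

  face-splitAt-inj₁ : ∀ {n} k (i : Fin (suc n)) p q (eq : suc p + q ≡ suc n) a b {j} →
    splitAt (suc p) (cast (sym eq) i) ≡ inj₁ j →
    A⊗B.face k i (suc p , q , eq , a , b) ≡ (p , q , suc-injective eq , A.face k j a , b)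
  face-splitAt-inj₁ k i p q eq a b s rewrite s = refl

  face-splitAt-inj₂ : ∀ {n} k (i : Fin (suc n)) p q (eq : p + suc q ≡ suc n) a b {j} →
    splitAt p (cast (sym eq) i) ≡ inj₂ j →
    A⊗B.face k i (p , suc q , eq , a , b) ≡ (p , q , suc-injective (trans (sym (+-suc p q)) eq) , a , B.face k j b)
  face-splitAt-inj₂ k i zero q eq a b refl = refl
  face-splitAt-inj₂ k i (suc p) q eq a b s rewrite s = refl

  face-↑ˡ : ∀ {n} k p q (eq : suc p + q ≡ suc n) (j : Fin (suc p)) a b →
    A⊗B.face k (cast eq (j ↑ˡ q)) (suc p , q , eq , a , b) ≡ (p , q , suc-injective eq , A.face k j a , b)
  face-↑ˡ k p q eq j a b = face-splitAt-inj₁ k (cast eq (j ↑ˡ q)) p q eq a b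
    (trans (cong (splitAt (suc p)) (cast-involutive (sym eq) eq (j ↑ˡ q))) (splitAt-↑ˡ (suc p) j q))

  face-↑ʳ : ∀ {n} k p q (eq : p + suc q ≡ suc n) (j : Fin (suc q)) a b →
    A⊗B.face k (cast eq (p ↑ʳ j)) (p , suc q , eq , a , b)
      ≡ (p , q , suc-injective (trans (sym (+-suc p q)) eq) , a , B.face k j b)
  face-↑ʳ k p q eq j a b = face-splitAt-inj₂ k (cast eq (p ↑ʳ j)) p q eq a b
    (trans (cong (splitAt p) (cast-involutive (sym eq) eq (p ↑ʳ j))) (splitAt-↑ʳ p (suc q) j))

  leftDim-face-< : ∀ {n} k (i : Fin (suc n)) (c : A⊗B.Cell (suc n)) → toℕ i < leftDim c →
    suc (leftDim (A⊗B.face k i c)) ≡ leftDim c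
  leftDim-face-< k i (suc p , q , eq , a , b) i<p with splitAt (suc p) (cast (sym eq) i) in s
  ... | inj₁ j = refl
  ... | inj₂ j = ⊥-elim (<⇒≱ i<p (begin
    suc p                    ≤⟨ m≤m+n (suc p) (toℕ j) ⟩
    suc p + toℕ j            ≡⟨ toℕ-splitAt-inj₂ s ⟩
    toℕ (cast (sym eq) i)    ≡⟨ toℕ-cast (sym eq) i ⟩
    toℕ i                    ∎))
    where open ≤-Reasoning

  leftDim-face-≥ : ∀ {n} k (i : Fin (suc n)) (c : A⊗B.Cell (suc n)) → leftDim c ≤ toℕ i →
    leftDim (A⊗B.face k i c) ≡ leftDim c
  leftDim-face-≥ k i (p , q , eq , a , b) p≤i with splitAt p (cast (sym eq) i) in s
  leftDim-face-≥ k i (p , q , eq , a , b) p≤i | inj₁ j =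
    ⊥-elim (<⇒≱ (subst (_< p) (trans (toℕ-splitAt-inj₁ s) (toℕ-cast (sym eq) i)) (toℕ<n j)) p≤i)
  leftDim-face-≥ k i (zero , suc q , eq , a , b) p≤i | inj₂ j = refl
  leftDim-face-≥ k i (suc p , suc q , eq , a , b) p≤i | inj₂ j = refl

  record SameFaces {n} (x y : A⊗B.Cell (suc (suc n))) : Set where
    constructor sameFaces
    field face≡ : ∀ (k : Bool) (r : Fin (suc (suc n))) → A⊗B.face k r x ≡ A⊗B.face k r y
  open SameFaces

  sameFaces-sym : ∀ {n} {x y : A⊗B.Cell (suc (suc n))} → SameFaces x y → SameFaces y x
  sameFaces-sym same = sameFaces λ k r → sym (face≡ same k r)

  sameFaces-at : ∀ {n} {x y : A⊗B.Cell (suc (suc n))} → SameFaces x y →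
    ∀ k r {u v} → A⊗B.face k r x ≡ u → A⊗B.face k r y ≡ v → u ≡ v
  sameFaces-at same k r x≡u y≡v = trans (sym x≡u) (trans (face≡ same k r) y≡v)

  sameFaces-leftDim-<⇒suc : ∀ {n} (x y : A⊗B.Cell (suc (suc n))) → SameFaces x y →
    leftDim x < leftDim y → suc (leftDim x) ≡ leftDim y
  sameFaces-leftDim-<⇒suc {n} x y same x<y = begin
    suc (leftDim x)                        ≡⟨ cong suc (sym (leftDim-face-≥ false i x (≤-reflexive (sym toℕ-i)))) ⟩
    suc (leftDim (A⊗B.face false i x))     ≡⟨ cong (λ c → suc (leftDim c)) (face≡ same false i) ⟩
    suc (leftDim (A⊗B.face false i y))     ≡⟨ leftDim-face-< false i y (subst (_< leftDim y) (sym toℕ-i) x<y) ⟩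
    leftDim y                              ∎
    where
    open ≡-Reasoning
    x<2+n : leftDim x < suc (suc n)
    x<2+n = <-≤-trans x<y (leftDim≤ y)
    i : Fin (suc (suc n))
    i = fromℕ< x<2+n
    toℕ-i : toℕ i ≡ leftDim x
    toℕ-i = toℕ-fromℕ< x<2+n

  sameFaces-leftDim-≢suc : ∀ {n} (x y : A⊗B.Cell (suc (suc n))) → SameFaces x y →
    suc (leftDim x) ≢ leftDim y
  sameFaces-leftDim-≢suc x@(zero , _) y same refl = 0≢1+n (begin
    0                                           ≡⟨ sym (leftDim-face-≥ false (suc zero) x z≤n) ⟩
    leftDim (A⊗B.face false (suc zero) x)       ≡⟨ cong leftDim (face≡ same false (suc zero)) ⟩
    leftDim (A⊗B.face false (suc zero) y)       ≡⟨ leftDim-face-≥ false (suc zero) y (s≤s z≤n) ⟩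
    1                                           ∎)
    where open ≡-Reasoning
  sameFaces-leftDim-≢suc x@(suc p , _) y same refl = 1+n≢n (begin
    suc (suc p)                                 ≡⟨ sym (leftDim-face-< false zero y (s≤s z≤n)) ⟩
    suc (leftDim (A⊗B.face false zero y))       ≡⟨ cong (λ c → suc (leftDim c)) (sym (face≡ same false zero)) ⟩
    suc (leftDim (A⊗B.face false zero x))       ≡⟨ leftDim-face-< false zero x (s≤s z≤n) ⟩
    suc p                                       ∎)
    where open ≡-Reasoning

  sameFaces-leftDim-≮ : ∀ {n} (x y : A⊗B.Cell (suc (suc n))) → SameFaces x y → ¬ leftDim x < leftDim y
  sameFaces-leftDim-≮ x y same x<y = sameFaces-leftDim-≢suc x y same (sameFaces-leftDim-<⇒suc x y same x<y)

  sameFaces⇒leftDim≡ : ∀ {n} (x y : A⊗B.Cell (suc (suc n))) → SameFaces x y → leftDim x ≡ leftDim y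
  sameFaces⇒leftDim≡ x y same with <-cmp (leftDim x) (leftDim y)
  ... | tri< x<y _ _ = ⊥-elim (sameFaces-leftDim-≮ x y same x<y)
  ... | tri≈ _ x≡y _ = x≡y
  ... | tri> _ _ y<x = ⊥-elim (sameFaces-leftDim-≮ y x (sameFaces-sym same) y<x)

  sameFaces⇒left≡ : HM3 A → ∀ {n} p q (eq : p + q ≡ suc (suc n)) {a a′ b b′} →
    SameFaces (p , q , eq , a , b) (p , q , eq , a′ , b′) → a ≡ a′
  sameFaces⇒left≡ hA p (suc q) eq same = proj₁ (⊗-cell-injective
    (sameFaces-at same false (cast eq (p ↑ʳ zero)) (face-↑ʳ false p q eq zero _ _) (face-↑ʳ false p q eq zero _ _)))
  sameFaces⇒left≡ hA {n} p zero eq {a} {a′} same with trans (sym (+-identityʳ p)) eq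
  ... | refl = hA n a a′ λ k r → proj₁ (⊗-cell-injective
    (sameFaces-at same k (cast eq (r ↑ˡ 0)) (face-↑ˡ k (suc n) 0 eq r _ _) (face-↑ˡ k (suc n) 0 eq r _ _)))

  sameFaces⇒right≡ : HM3 B → ∀ {n} p q (eq : p + q ≡ suc (suc n)) {a a′ b b′} →
    SameFaces (p , q , eq , a , b) (p , q , eq , a′ , b′) → b ≡ b′
  sameFaces⇒right≡ hB (suc p) q eq same = proj₂ (⊗-cell-injective
    (sameFaces-at same false (cast eq (zero ↑ˡ q)) (face-↑ˡ false p q eq zero _ _) (face-↑ˡ false p q eq zero _ _)))
  sameFaces⇒right≡ hB {n} zero q refl {b = b} {b′} same = hB n b b′ λ k r → proj₂ (⊗-cell-injective
    (sameFaces-at same k (cast refl (0 ↑ʳ r)) (face-↑ʳ k 0 (suc n) refl r _ _) (face-↑ʳ k 0 (suc n) refl r _ _)))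

  ⊗-HM3 : HM3 A → HM3 B → HM3 (A ⊗ B)
  ⊗-HM3 hA hB n x@(p , q , eq , _) y@(_ , q′ , eq′ , _) faces≡ with sameFaces⇒leftDim≡ x y (sameFaces faces≡)
  ... | refl with +-cancelˡ-≡ p q q′ (trans eq (sym eq′))
  ... | refl with ≡-irrelevant eq eq′
  ... | refl = cong₂ (λ a b → p , q , eq , a , b)
    (sameFaces⇒left≡ hA p q eq (sameFaces faces≡)) (sameFaces⇒right≡ hB p q eq (sameFaces faces≡))

open ⊗-Cubes using (⊗-HM3)

⊗-HM2 : ∀ {L₁ L₂} (S : ⋉TS L₁) (T : ⋉TS L₂) {A : PreHDA L₁} {B : PreHDA L₂} →
  HM2 A (⋉TS._⋉_ S) → HM2 B (⋉TS._⋉_ T) → HM2 (A ⊗ B) (interleave-⋉ S T)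
⊗-HM2 S T hA hB (suc (suc zero) , zero , refl , a , b) = hA a
⊗-HM2 S T hA hB (suc zero , suc zero , refl , a , b) = _
⊗-HM2 S T hA hB (zero , suc (suc zero) , refl , a , b) = hB b
⊗-HM2 S T hA hB (zero , zero , () , a , b)
⊗-HM2 S T hA hB (zero , suc zero , () , a , b)
⊗-HM2 S T hA hB (zero , suc (suc (suc q)) , () , a , b)
⊗-HM2 S T hA hB (suc zero , zero , () , a , b)
⊗-HM2 S T hA hB (suc zero , suc (suc q) , () , a , b)
⊗-HM2 S T hA hB (suc (suc zero) , suc q , () , a , b)
⊗-HM2 S T hA hB (suc (suc (suc p)) , q , () , a , b)

module _ {L₁ L₂ : Set} (X : PreHDA L₁) (Y : PreHDA L₂) where
  private
    module X = PreHDA X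
    module Y = PreHDA Y
    module X⊗Y = PreHDA (X ⊗ Y)

  data Vertex⊗ : X⊗Y.Cell 0 → Set where
    vertex : (a : X.Cell 0) (b : Y.Cell 0) → Vertex⊗ (0 , 0 , refl , a , b)

  vertex⊗ : (v : X⊗Y.Cell 0) → Vertex⊗ v
  vertex⊗ (zero , zero , refl , a , b) = vertex a b
  vertex⊗ (zero , suc q , () , a , b)
  vertex⊗ (suc p , q , () , a , b)

  data Edge⊗ : X⊗Y.Cell 1 → Set where
    edgeˡ : (a : X.Cell 1) (b : Y.Cell 0) → Edge⊗ (1 , 0 , refl , a , b)
    edgeʳ : (a : X.Cell 0) (b : Y.Cell 1) → Edge⊗ (0 , 1 , refl , a , b)

  edge⊗ : (e : X⊗Y.Cell 1) → Edge⊗ e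
  edge⊗ (suc zero , zero , refl , a , b) = edgeˡ a b
  edge⊗ (zero , suc zero , refl , a , b) = edgeʳ a b
  edge⊗ (zero , zero , () , a , b)
  edge⊗ (zero , suc (suc q) , () , a , b)
  edge⊗ (suc zero , suc q , () , a , b)
  edge⊗ (suc (suc p) , q , () , a , b)

record Map≤1 {L : Set} (X X′ : PreHDA L) : Set where
  field
    map₀ : PreHDA.Cell X 0 → PreHDA.Cell X′ 0
    map₁ : PreHDA.Cell X 1 → PreHDA.Cell X′ 1
open Map≤1

Section≤1 : ∀ {L} {X X′ : PreHDA L} → Map≤1 X X′ → Map≤1 X′ X → Set
Section≤1 f h = (∀ x → map₀ f (map₀ h x) ≡ x) × (∀ x → map₁ f (map₁ h x) ≡ x)

⊗-map≤1 : ∀ {L₁ L₂} {X X′ : PreHDA L₁} {Y Y′ : PreHDA L₂} → Map≤1 X X′ → Map≤1 Y Y′ →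
  ∀ n → PreHDA.Cell (truncate≤1 (X ⊗ Y)) n → PreHDA.Cell (truncate≤1 (X′ ⊗ Y′)) n
⊗-map≤1 {X = X} {Y = Y} f g zero v with vertex⊗ X Y v
... | vertex a b = 0 , 0 , refl , map₀ f a , map₀ g b
⊗-map≤1 {X = X} {Y = Y} f g (suc zero) e with edge⊗ X Y e
... | edgeˡ a b = 1 , 0 , refl , map₁ f a , map₀ g b
... | edgeʳ a b = 0 , 1 , refl , map₀ f a , map₁ g b
⊗-map≤1 f g (suc (suc n)) ()

⊗-map≤1-section : ∀ {L₁ L₂} {X X′ : PreHDA L₁} {Y Y′ : PreHDA L₂}
  {f : Map≤1 X X′} {h : Map≤1 X′ X} {g : Map≤1 Y Y′} {k : Map≤1 Y′ Y} →
  Section≤1 f h → Section≤1 g k → ∀ n x → ⊗-map≤1 f g n (⊗-map≤1 h k n x) ≡ x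
⊗-map≤1-section {X′ = X′} {Y′ = Y′} (fh₀ , _) (gk₀ , _) zero v with vertex⊗ X′ Y′ v
... | vertex a b = cong₂ (λ a b → 0 , 0 , refl , a , b) (fh₀ a) (gk₀ b)
⊗-map≤1-section {X′ = X′} {Y′ = Y′} (fh₀ , fh₁) (gk₀ , gk₁) (suc zero) e with edge⊗ X′ Y′ e
... | edgeˡ a b = cong₂ (λ a b → 1 , 0 , refl , a , b) (fh₁ a) (gk₀ b)
... | edgeʳ a b = cong₂ (λ a b → 0 , 1 , refl , a , b) (fh₀ a) (gk₁ b)
⊗-map≤1-section _ _ (suc (suc n)) ()

module _ {L : Set} {X X′ : PreHDA L} (ι : truncate≤1 X ≅ X′) where
  private
    module ι = _≅_ ι

  ≅-to≤1 : Map≤1 X X′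
  ≅-to≤1 = record { map₀ = Inverse.to (ι.iso 0) ; map₁ = Inverse.to (ι.iso 1) }

  ≅-from≤1 : Map≤1 X′ X
  ≅-from≤1 = record { map₀ = Inverse.from (ι.iso 0) ; map₁ = Inverse.from (ι.iso 1) }

  ≅-to≤1-section : Section≤1 ≅-to≤1 ≅-from≤1
  ≅-to≤1-section = Inverse.strictlyInverseˡ (ι.iso 0) , Inverse.strictlyInverseˡ (ι.iso 1)

  ≅-from≤1-section : Section≤1 ≅-from≤1 ≅-to≤1
  ≅-from≤1-section = Inverse.strictlyInverseʳ (ι.iso 0) , Inverse.strictlyInverseʳ (ι.iso 1)

⊗-HM1 : ∀ {L₁ L₂} {X X′ : PreHDA L₁} {Y Y′ : PreHDA L₂} →
  HM1 X X′ → HM1 Y Y′ → HM1 (X ⊗ Y) (truncate≤1 (X′ ⊗ Y′))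
⊗-HM1 {X = X} {X′} {Y} {Y′} ιX ιY = record
  { iso        = λ n → mk↔ₛ′ (to n) (from n)
                   (⊗-map≤1-section (≅-to≤1-section ιX) (≅-to≤1-section ιY) n)
                   (⊗-map≤1-section (≅-from≤1-section ιX) (≅-from≤1-section ιY) n)
  ; face-pres  = face-pres
  ; init-pres  = cong₂ (λ a b → 0 , 0 , refl , a , b) ιX.init-pres ιY.init-pres
  ; final-pres = final-pres
  ; lab-pres   = lab-pres
  }
  where
  module ιX = _≅_ ιX
  module ιY = _≅_ ιY
  module X⊗Y≤1 = PreHDA (truncate≤1 (X ⊗ Y))
  module X′⊗Y′≤1 = PreHDA (truncate≤1 (X′ ⊗ Y′))

  to : ∀ n → X⊗Y≤1.Cell n → X′⊗Y′≤1.Cell n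
  to = ⊗-map≤1 (≅-to≤1 ιX) (≅-to≤1 ιY)

  from : ∀ n → X′⊗Y′≤1.Cell n → X⊗Y≤1.Cell n
  from = ⊗-map≤1 (≅-from≤1 ιX) (≅-from≤1 ιY)

  face-pres : ∀ {n} k (i : Fin (suc n)) (x : X⊗Y≤1.Cell (suc n)) →
    to n (X⊗Y≤1.face k i x) ≡ X′⊗Y′≤1.face k i (to (suc n) x)
  face-pres {zero} k zero e with edge⊗ X Y e
  ... | edgeˡ a b = cong (λ a → 0 , 0 , refl , a , ιY.map b) (ιX.face-pres k zero a)
  ... | edgeʳ a b = cong (λ b → 0 , 0 , refl , ιX.map a , b) (ιY.face-pres k zero b)
  face-pres {suc n} k i ()

  final-pres : (v : X⊗Y≤1.Cell 0) → X⊗Y≤1.Final v ⇔ X′⊗Y′≤1.Final (to 0 v)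
  final-pres v with vertex⊗ X Y v
  ... | vertex a b = ιX.final-pres a ×-⇔ ιY.final-pres b

  lab-pres : (e : X⊗Y≤1.Cell 1) → X′⊗Y′≤1.lab (to 1 e) ≡ X⊗Y≤1.lab e
  lab-pres e with edge⊗ X Y e
  ... | edgeˡ a b = cong inj₁ (ιX.lab-pres a)
  ... | edgeʳ a b = cong inj₂ (ιY.lab-pres b)

proposition5p3 : {L₁ L₂ : Set} (S : ⋉TS L₁) (T : ⋉TS L₂) (A : HDA L₁) (B : HDA L₂) →
    IsHDAModel A S → IsHDAModel B T →
    HM1 (HDA.pre A ⊗ HDA.pre B) (interleave-U S T)
      × HM2 (HDA.pre A ⊗ HDA.pre B) (interleave-⋉ S T)
      × HM3 (HDA.pre A ⊗ HDA.pre B)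
proposition5p3 S T A B 𝒜 ℬ =
  ⊗-HM1 (IsHDAModel.hm1 𝒜) (IsHDAModel.hm1 ℬ) ,
  ⊗-HM2 S T (IsHDAModel.hm2 𝒜) (IsHDAModel.hm2 ℬ) ,
  ⊗-HM3 (HDA.pre A) (HDA.pre B) (IsHDAModel.hm3 𝒜) (IsHDAModel.hm3 ℬ)
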